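{- $gr^3_2(B_{10})=17$.
   Context: $K_n$ is the complete graph of order $n$. The book $B_n:=K_2+nK_1$ (graph join) is the graph on $n+2$ vertices consisting of an edge $xy$ (the spine) together with $n$ further, pairwise non-adjacent vertices (the pages), each adjacent to both $x$ and $y$. A $t$-coloring of $K_p$ is a map $f:E(K_p)\to\{1,\dots,t\}$, not assumed surjective. A Gallai $t$-coloring is a $t$-coloring with no rainbow triangle, i.e. there are no three vertices $x,y,z$ such that $f(xy),f(xz),f(yz)$ are pairwise distinct. For $1\le s<t$ and a graph $G$, the weakened Gallai-Ramsey number $gr^t_s(G)$ is the least $p\in\mathbb{N}$ such that every Gallai $t$-coloring of $K_p$ contains a (not necessarily induced) subgraph isomorphic to $G$ whose edges use at most $s$ colors. -}

module Defs where

open import Data.Empty using (⊥)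
open import Data.Fin using (Fin)
open import Data.Fin.Subset using (Subset; _∈_; ∣_∣)
open import Data.Nat using (ℕ; _≤_)
open import Data.Product using (Σ-syntax; ∃-syntax; _×_)
open import Data.Sum using (_⊎_; inj₁; inj₂)
open import Data.Unit using (⊤; tt)
open import Function.Definitions using (Injective)
open import Relation.Binary.PropositionalEquality
  using (_≡_; _≢_; refl; sym; ≢-sym)
open import Relation.Nullary using (¬_)

record Graph : Set₁ where
  field
    Vertex     : Set
    Adj        : Vertex → Vertex → Set
    adj-sym    : ∀ {u v} → Adj u v → Adj v u
    adj-irrefl : ∀ {v} → ¬ Adj v v

open Graph public

K : ℕ → Graph
K n = record
  { Vertex     = Fin n
  ; Adj        = _≢_
  ; adj-sym    = ≢-sym
  ; adj-irrefl = λ v≢v → v≢v refl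
  }

-- The graph nK₁: n isolated vertices.
Edgeless : ℕ → Graph
Edgeless n = record
  { Vertex     = Fin n
  ; Adj        = λ _ _ → ⊥
  ; adj-sym    = λ ()
  ; adj-irrefl = λ ()
  }

module _ (G H : Graph) where

  JoinAdj : Vertex G ⊎ Vertex H → Vertex G ⊎ Vertex H → Set
  JoinAdj (inj₁ u) (inj₁ v) = Adj G u v
  JoinAdj (inj₁ _) (inj₂ _) = ⊤
  JoinAdj (inj₂ _) (inj₁ _) = ⊤
  JoinAdj (inj₂ u) (inj₂ v) = Adj H u v

  joinAdj-sym : ∀ u v → JoinAdj u v → JoinAdj v u
  joinAdj-sym (inj₁ _) (inj₁ _) e = adj-sym G e
  joinAdj-sym (inj₁ _) (inj₂ _) _ = tt
  joinAdj-sym (inj₂ _) (inj₁ _) _ = tt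
  joinAdj-sym (inj₂ _) (inj₂ _) e = adj-sym H e

  joinAdj-irrefl : ∀ v → ¬ JoinAdj v v
  joinAdj-irrefl (inj₁ _) = adj-irrefl G
  joinAdj-irrefl (inj₂ _) = adj-irrefl H

  join : Graph
  join = record
    { Vertex     = Vertex G ⊎ Vertex H
    ; Adj        = JoinAdj
    ; adj-sym    = λ {u} {v} → joinAdj-sym u v
    ; adj-irrefl = λ {v} → joinAdj-irrefl v
    }

Book : ℕ → Graph
Book n = join (K 2) (Edgeless n)

-- Irrelevance of the adjacency proof, together with colour-sym, makes this a
-- function of the unordered edge {u, v}; nothing is coloured on the diagonal.
record Coloring (t : ℕ) (G : Graph) : Set where
  field
    colour     : ∀ u v → .(Adj G u v) → Fin t
    colour-sym : ∀ u v .(e : Adj G u v) →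
                 colour u v e ≡ colour v u (adj-sym G e)

open Coloring public

RainbowTriangle : ∀ {t G} → Coloring t G → Set
RainbowTriangle {G = G} f =
  ∃[ x ] ∃[ y ] ∃[ z ]
  Σ[ xy ∈ Adj G x y ] Σ[ xz ∈ Adj G x z ] Σ[ yz ∈ Adj G y z ]
    colour f x y xy ≢ colour f x z xz
  × colour f x y xy ≢ colour f y z yz
  × colour f x z xz ≢ colour f y z yz

Gallai : ∀ {t G} → Coloring t G → Set
Gallai f = ¬ RainbowTriangle f

-- A not necessarily induced subgraph of H isomorphic to G, presented as the
-- image of an injective homomorphism.
record Copy (G H : Graph) : Set where
  field
    embed     : Vertex G → Vertex H
    injective : Injective _≡_ _≡_ embed
    preserves : ∀ {u v} → Adj G u v → Adj H (embed u) (embed v)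

open Copy public

-- Only the edges of the copy count, not all edges induced on its vertices.
UsesAtMost : ∀ {t G H} → ℕ → Coloring t H → Copy G H → Set
UsesAtMost {t} {G} s f c =
  Σ[ S ∈ Subset t ] ∣ S ∣ ≤ s
  × (∀ u v (e : Adj G u v) →
       colour f (embed c u) (embed c v) (preserves c e) ∈ S)

GallaiArrows : (t s : ℕ) → Graph → ℕ → Set
GallaiArrows t s G p =
  (f : Coloring t (K p)) → Gallai f → Σ[ c ∈ Copy G (K p) ] UsesAtMost s f c

IsLeast : (ℕ → Set) → ℕ → Set
IsLeast P p = P p × (∀ q → P q → p ≤ q)

-- gr^t_s(G) = p, for 1 ≤ s < t.  The number is given by its graph since its
-- existence is not a matter of definition.
gr[_,_]_≈_ : (t s : ℕ) → Graph → ℕ → Set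
gr[ t , s ] G ≈ p = IsLeast (GallaiArrows t s G) p

{-# OPTIONS --safe #-}

-- Upper bound.  If no copy of B₁₀ misses a colour, then for every edge uv and every
-- colour d other than that of uv at least 17 - 2 - 9 = 6 vertices are d-adjacent to u or v
-- (the remaining ones are pages).  Some colour c of a Gallai colouring is disconnected, and
-- any two c-components are joined in a single colour.  Packing disjoint sets of vertices
-- rules out four components; with two or three, one side S, of at most 8 vertices, of a cut
-- is joined to the rest in one colour r.  Inside S there is no r-edge, an edge of another
-- colour forces |S| = 8 and no monochromatic triangle in S, which R(3,3) = 6 forbids; so S is
-- a single vertex y.  All edges at y have colour r, and the same analysis of the remaining
-- 16 vertices ends in a contradiction.
--
-- Lower bound.  Two copies of the Paley graph of order 9 minus a vertex, coloured in colours
-- 0 and 1 and joined in colour 2.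
module Submission where

open import Defs
open import Algebra.Properties.CommutativeSemigroup using (interchange; x∙yz≈y∙xz)
open import Data.Bool using (if_then_else_; _∨_)
open import Data.Empty using (⊥; ⊥-elim)
open import Data.Fin using (Fin; zero; suc; _≟_; inject₁; inject≤; punchIn; remQuot)
open import Data.Fin.Patterns using (0F; 1F; 2F; 3F)
open import Data.Fin.Properties
  using (all?; any?; inject≤-injective; punchIn-injective; punchInᵢ≢i; suc-injective; ¬∀⟶∃¬)
open import Data.Fin.Subset as Subset using (Subset; ∁; ⁅_⁆; ∣_∣)
open import Data.Fin.Subset.Properties
  using (_∈?_; p⊆q⇒∣p∣≤∣q∣; x∈⁅y⁆⇒x≡y; x∉p⇒x∈∁p; ∣∁p∣≡n∸∣p∣; ∣⁅x⁆∣≡1)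
open import Data.List using (List; []; _∷_; map)
open import Data.List.Relation.Unary.All as All using (All; []; _∷_)
open import Data.List.Relation.Unary.AllPairs using (AllPairs; []; _∷_; allPairs?)
open import Data.Maybe using (Maybe; just; nothing)
open import Data.Maybe.Properties using (just-injective; ≡-dec)
open import Data.Nat using (ℕ; zero; suc; _+_; _∸_; _≤_; _<_; z≤n; s≤s; s≤s⁻¹; _≤?_)
open import Data.Nat.ListAction using (sum)
open import Data.Nat.Properties as ℕ
  using (+-assoc; +-cancelˡ-≤; +-comm; +-mono-≤; +-monoʳ-≤; 1+n≰n; ≤-refl; ≤-reflexive; ≤-trans; ≰⇒>)
open import Data.Product using (Σ-syntax; ∃; ∃₂; _×_; _,_; -,_; proj₁; proj₂)
open import Data.Sum using (_⊎_; inj₁; inj₂; [_,_])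
open import Data.Sum.Properties using (inj₂-injective)
open import Data.Unit using (tt)
open import Function using (_∘_)
open import Function.Definitions using (Injective)
open import Level using (0ℓ)
open import Relation.Binary using (Rel; Symmetric) renaming (Decidable to Decidable₂)
open import Relation.Binary.Construct.Closure.ReflexiveTransitive as Star using (Star; ε; _◅_; _◅◅_)
open import Relation.Binary.PropositionalEquality
  using (_≡_; _≢_; refl; sym; trans; cong; cong₂; subst; ≢-sym)
open import Relation.Nullary using (¬_; Dec; yes; no; does; contradiction)
open import Relation.Nullary.Decidable
  using (decidable-stable; from-no; from-yes; ¬?; _×-dec_; _⊎-dec_; _→-dec_)
open import Relation.Unary using (Pred; Decidable; _⊆_; U)
open import Relation.Unary.Properties using (_∩?_; _∪?_; U?; ∁?)

private variable
  n m : ℕ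
  P Q R : Pred (Fin n) 0ℓ

-- Counting

⟦_⟧ : ∀ {A : Set} → Dec A → ℕ
⟦ a? ⟧ = if does a? then 1 else 0

opaque
  # : Decidable {A = Fin n} P → ℕ
  # {zero}  P? = 0
  # {suc n} P? = ⟦ P? zero ⟧ + # (P? ∘ suc)

  #-U : ∀ n → # {n} U? ≡ n
  #-U zero    = refl
  #-U (suc n) = cong suc (#-U n)

  #-empty : (P? : Decidable {A = Fin n} P) → (∀ z → ¬ P z) → # P? ≡ 0
  #-empty {zero}  P? ¬P = refl
  #-empty {suc n} P? ¬P with P? zero
  ... | yes p = contradiction p (¬P zero)
  ... | no  _ = #-empty (P? ∘ suc) (¬P ∘ suc)

  #-cong : (P? : Decidable {A = Fin n} P) (Q? : Decidable Q) → P ⊆ Q → Q ⊆ P → # P? ≡ # Q?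
  #-cong {zero}  P? Q? P⊆Q Q⊆P = refl
  #-cong {suc n} P? Q? P⊆Q Q⊆P =
    cong₂ _+_ head (#-cong (P? ∘ suc) (Q? ∘ suc) P⊆Q Q⊆P)
    where
    head : ⟦ P? zero ⟧ ≡ ⟦ Q? zero ⟧
    head with P? zero | Q? zero
    ... | yes _ | yes _ = refl
    ... | no  _ | no  _ = refl
    ... | yes p | no ¬q = contradiction (P⊆Q p) ¬q
    ... | no ¬p | yes q = contradiction (Q⊆P q) ¬p

  #-singleton : (x : Fin n) → # (_≟ x) ≡ 1
  #-singleton {suc n} zero    = cong suc (#-empty {n = n} (λ z → suc z ≟ zero) (λ _ ()))
  #-singleton {suc n} (suc x) = trans
    (#-cong {n = n} (λ z → suc z ≟ suc x) (_≟ x) suc-injective (cong suc))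
    (#-singleton x)

  #-cover : (R? : Decidable {A = Fin n} R) (P? : Decidable P) (Q? : Decidable Q) →
            (∀ {z} → R z → P z ⊎ Q z) → # R? ≤ # P? + # Q?
  #-cover {zero}  R? P? Q? cov = z≤n
  #-cover {suc n} R? P? Q? cov = ≤-trans
    (+-mono-≤ head (#-cover (R? ∘ suc) (P? ∘ suc) (Q? ∘ suc) cov))
    (≤-reflexive (interchange ℕ.+-commutativeSemigroup ⟦ P? zero ⟧ ⟦ Q? zero ⟧ _ _))
    where
    head : ⟦ R? zero ⟧ ≤ ⟦ P? zero ⟧ + ⟦ Q? zero ⟧
    head with R? zero | P? zero | Q? zero
    ... | no  _ | _     | _     = z≤n
    ... | yes _ | yes _ | _     = s≤s z≤n
    ... | yes _ | no  _ | yes _ = ≤-refl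
    ... | yes r | no ¬p | no ¬q with cov r
    ... | inj₁ p = contradiction p ¬p
    ... | inj₂ q = contradiction q ¬q

  #-disjoint : (P? : Decidable {A = Fin n} P) (Q? : Decidable Q) (R? : Decidable R) →
               P ⊆ R → Q ⊆ R → (∀ {z} → P z → ¬ Q z) → # P? + # Q? ≤ # R?
  #-disjoint {zero}  P? Q? R? P⊆R Q⊆R dis = z≤n
  #-disjoint {suc n} P? Q? R? P⊆R Q⊆R dis = ≤-trans
    (≤-reflexive (interchange ℕ.+-commutativeSemigroup ⟦ P? zero ⟧ _ ⟦ Q? zero ⟧ _))
    (+-mono-≤ head (#-disjoint (P? ∘ suc) (Q? ∘ suc) (R? ∘ suc) P⊆R Q⊆R dis))
    where
    head : ⟦ P? zero ⟧ + ⟦ Q? zero ⟧ ≤ ⟦ R? zero ⟧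
    head with P? zero | Q? zero | R? zero
    ... | no  _ | no  _ | _     = z≤n
    ... | yes p | yes q | _     = contradiction q (dis p)
    ... | yes _ | no  _ | yes _ = ≤-refl
    ... | no  _ | yes _ | yes _ = ≤-refl
    ... | yes p | no  _ | no ¬r = contradiction (P⊆R p) ¬r
    ... | no  _ | yes q | no ¬r = contradiction (Q⊆R q) ¬r

Event : ℕ → Set₁
Event n = ∃ λ (P : Pred (Fin n) 0ℓ) → Decidable P

Disjoint : Event n → Event n → Set
Disjoint (P , _) (Q , _) = ∀ {z} → P z → ¬ Q z

-- Peel off the first event: the others lie in what remains of `R`. Most contradictions below
-- exhibit disjoint vertex sets whose sizes add up to too much.
pack-⊆ : (R? : Decidable {A = Fin n} R) (es : List (Event n)) →
         All (λ e → proj₁ e ⊆ R) es → AllPairs Disjoint es →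
         sum (map (λ e → # (proj₂ e)) es) ≤ # R?
pack-⊆ R? []              []          []          = z≤n
pack-⊆ R? ((P , P?) ∷ es) (P⊆R ∷ es⊆) (dis ∷ diss) = ≤-trans
  (+-monoʳ-≤ (# P?) (pack-⊆ (R? ∩? ∁? P?) es
    (All.zipWith (λ (Q⊆R , P∩Q) {_} q → Q⊆R q , λ p → P∩Q p q) (es⊆ , dis)) diss))
  (#-disjoint P? (R? ∩? ∁? P?) R? P⊆R proj₁ (λ p r → proj₂ r p))

pack : (es : List (Event n)) → AllPairs Disjoint es →
       sum (map (λ e → # (proj₂ e)) es) ≤ n
pack {n} es dis = ≤-trans (pack-⊆ U? es (All.universal (λ _ {_} _ → tt) es) dis) (≤-reflexive (#-U n))

#-complement : (P? : Decidable {A = Fin n} P) → n ≤ # P? + # (∁? P?)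
#-complement {n} P? = ≤-trans (≤-reflexive (sym (#-U n))) (#-cover U? P? (∁? P?) split)
  where
  split : ∀ {z} → U z → _
  split {z} _ with P? z
  ... | yes p = inj₁ p
  ... | no ¬p = inj₂ ¬p

#-remove : (P? : Decidable {A = Fin n} P) (x : Fin n) → # P? ≤ 1 + # (P? ∩? ∁? (_≟ x))
#-remove P? x = subst (λ k → # P? ≤ k + # (P? ∩? ∁? (_≟ x))) (#-singleton x)
  (#-cover P? (_≟ x) (P? ∩? ∁? (_≟ x)) split)
  where
  split : ∀ {z} → _ → _
  split {z} p with z ≟ x
  ... | yes z≡x = inj₁ z≡x
  ... | no  z≢x = inj₂ (p , z≢x)

opaque
  unfolding #

  -- The map `punchIn y` skips `y`, so this tracks a count when an arbitrary vertex is deleted,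
  -- later the apex of a cone.
  #-punchIn : (P? : Decidable {A = Fin (suc n)} P) (y : Fin (suc n)) →
              # P? ≡ ⟦ P? y ⟧ + # (P? ∘ punchIn y)
  #-punchIn {n}     P? zero    = refl
  #-punchIn {suc n} P? (suc y) = trans
    (cong (⟦ P? zero ⟧ +_) (#-punchIn (P? ∘ suc) y))
    (x∙yz≈y∙xz ℕ.+-commutativeSemigroup ⟦ P? zero ⟧ ⟦ P? (suc y) ⟧ (# (P? ∘ suc ∘ punchIn y)))

#-punchIn-≤ : (P? : Decidable {A = Fin (suc n)} P) (y : Fin (suc n)) →
              # P? ≤ 1 + # (P? ∘ punchIn y)
#-punchIn-≤ P? y with P? y | #-punchIn P? y
... | yes _ | eq = ≤-reflexive eq
... | no  _ | eq = ≤-trans (≤-reflexive eq) (ℕ.m≤n+m _ 1)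

#-punchIn-∉ : (P? : Decidable {A = Fin (suc n)} P) (y : Fin (suc n)) → ¬ P y →
              # P? ≤ # (P? ∘ punchIn y)
#-punchIn-∉ P? y ¬p with P? y | #-punchIn P? y
... | yes p | _  = contradiction p ¬p
... | no  _ | eq = ≤-reflexive eq

opaque
  unfolding #

  -- Turns a lower bound on a count into actual distinct vertices, such as the pages of a book.
  enumerate : ∀ m (P? : Decidable {A = Fin n} P) → m ≤ # P? →
              Σ[ f ∈ (Fin m → Fin n) ] Injective _≡_ _≡_ f × (∀ i → P (f i))
  enumerate zero P? _ = (λ ()) , (λ { {()} }) , λ ()
  enumerate {suc n} {P} (suc m) P? m<#P with P? zero
  enumerate {suc n} {P} (suc m) P? m<#P | no _ with enumerate (suc m) (P? ∘ suc) m<#P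
  ... | f , f-inj , f∈P = suc ∘ f , f-inj ∘ suc-injective , f∈P
  enumerate {suc n} {P} (suc m) P? (s≤s m≤#P) | yes p with enumerate m (P? ∘ suc) m≤#P
  ... | f , f-inj , f∈P = g , g-inj , g∈P
    where
    g : Fin (suc m) → Fin (suc n)
    g zero    = zero
    g (suc i) = suc (f i)
    g-inj : Injective _≡_ _≡_ g
    g-inj {zero}  {zero}  _  = refl
    g-inj {suc i} {suc j} eq = cong suc (f-inj (suc-injective eq))
    g∈P : ∀ i → P (g i)
    g∈P zero    = p
    g∈P (suc i) = f∈P i

1≤# : (x : Fin n) → 1 ≤ # (_≟ x)
1≤# x = ≤-reflexive (sym (#-singleton x))

#-mono : (P? : Decidable {A = Fin n} P) (Q? : Decidable Q) → P ⊆ Q → # P? ≤ # Q?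
#-mono P? Q? P⊆Q = ≤-trans (ℕ.m≤m+n (# P?) 0) (pack-⊆ Q? ((-, P?) ∷ []) (P⊆Q ∷ []) ([] ∷ []))

#-injective : ∀ {m} (P? : Decidable {A = Fin n} P) (f : Fin m → Fin n) →
              Injective _≡_ _≡_ f → (∀ i → P (f i)) → m ≤ # P?
#-injective {m = zero}  P? f f-inj f∈P = z≤n
#-injective {m = suc m} P? f f-inj f∈P = ≤-trans
  (+-mono-≤ (1≤# (f zero)) (#-injective (P? ∩? ∁? (_≟ f zero)) (f ∘ suc) (suc-injective ∘ f-inj)
    λ i → f∈P (suc i) , λ eq → 1+i≢0 (f-inj eq)))
  (#-disjoint (_≟ f zero) (P? ∩? ∁? (_≟ f zero)) P? (λ { refl → f∈P zero }) proj₁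
    λ z≡f₀ (_ , z≢f₀) → z≢f₀ z≡f₀)
  where
  1+i≢0 : ∀ {i : Fin m} → suc i ≢ zero
  1+i≢0 ()

-- Components of a colour and Gallai’s theorem

record Components (R : Rel (Fin n) 0ℓ) : Set where
  field
    label    : Fin n → ℕ
    sound    : ∀ {u v} → R u v → label u ≡ label v
    complete : ∀ {u v} → label u ≡ label v → Star R u v

open Components

opaque
  -- Vertices are added one at a time: `zero` gets label 0 together with every component of the rest
  -- that it touches, and the other labels move up by one.
  components : {R : Rel (Fin n) 0ℓ} → Decidable₂ R → Symmetric R → Components R
  components {zero} R? R-sym = record
    { label = λ () ; sound = λ { {()} } ; complete = λ { {()} } }
  components {suc n} {R} R? R-sym = record
    { label = label⁺ ; sound = λ {u} {v} → sound⁺ u v ; complete = λ {u} {v} → complete⁺ u v }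
    where
    rest : Components (λ u v → R (suc u) (suc v))
    rest = components (λ u v → R? (suc u) (suc v)) R-sym
    Touched : Fin n → Set
    Touched u = ∃ λ w → R zero (suc w) × label rest w ≡ label rest u
    touched? : ∀ u → Dec (Touched u)
    touched? u = any? (λ w → R? zero (suc w) ×-dec (label rest w ℕ.≟ label rest u))
    label⁺ : Fin (suc n) → ℕ
    label⁺ zero = 0
    label⁺ (suc u) with touched? u
    ... | yes _ = 0
    ... | no  _ = suc (label rest u)
    sound⁺ : ∀ u v → R u v → label⁺ u ≡ label⁺ v
    sound⁺ zero zero r = refl
    sound⁺ zero (suc v) r with touched? v
    ... | yes _ = refl
    ... | no ¬t = contradiction (v , r , refl) ¬t
    sound⁺ (suc u) zero r with touched? u
    ... | yes _ = refl
    ... | no ¬t = contradiction (u , R-sym r , refl) ¬t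
    sound⁺ (suc u) (suc v) r with touched? u | touched? v
    ... | yes _ | yes _ = refl
    ... | no  _ | no  _ = cong suc (sound rest r)
    ... | yes (w , q , eq) | no ¬t = contradiction (w , q , trans eq (sound rest r)) ¬t
    ... | no ¬t | yes (w , q , eq) = contradiction (w , q , trans eq (sym (sound rest r))) ¬t
    inside : ∀ {u v} → label rest u ≡ label rest v → Star R (suc u) (suc v)
    inside eq = Star.gmap suc (λ r → r) (complete rest eq)
    from-zero : ∀ {u} → Touched u → Star R zero (suc u)
    from-zero (w , r , eq) = r ◅ inside eq
    complete⁺ : ∀ u v → label⁺ u ≡ label⁺ v → Star R u v
    complete⁺ zero zero _ = ε
    complete⁺ zero (suc v) eq with touched? v
    ... | yes t = from-zero t
    complete⁺ (suc u) zero eq with touched? u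
    ... | yes t = Star.reverse R-sym (from-zero t)
    complete⁺ (suc u) (suc v) eq with touched? u | touched? v
    ... | yes t | yes s = Star.reverse R-sym (from-zero t) ◅◅ from-zero s
    ... | no  _ | no  _ = inside (ℕ.suc-injective eq)

-- Gallai colourings in three colours

Colour : Set
Colour = Fin 3

opaque
  third : ∀ (c d : Colour) → ∃ λ e → e ≢ c × e ≢ d
  third = from-yes (all? {n = 3} λ c → all? {n = 3} λ d → any? λ e → ¬? (e ≟ c) ×-dec ¬? (e ≟ d))

record Palette (c d e : Colour) : Set where
  constructor palette
  field
    c≢d : c ≢ d
    c≢e : c ≢ e
    d≢e : d ≢ e

pal-swap : ∀ {c d e} → Palette c d e → Palette c e d
pal-swap (palette c≢d c≢e d≢e) = palette c≢e c≢d (d≢e ∘ sym)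

pal-rotate : ∀ {c d e} → Palette c d e → Palette d e c
pal-rotate (palette c≢d c≢e d≢e) = palette d≢e (c≢d ∘ sym) (c≢e ∘ sym)

complete-palette : ∀ {c d} → c ≢ d → ∃ (Palette c d)
complete-palette {c} {d} c≢d with third c d
... | e , e≢c , e≢d = e , palette c≢d (e≢c ∘ sym) (e≢d ∘ sym)

palette-of : ∀ c → ∃₂ (Palette c)
palette-of c with third c c
... | d , d≢c , _ = d , complete-palette (d≢c ∘ sym)

opaque
  -- Pigeonhole: only two colours other than `c` remain.
  two-of-three : ∀ (c p q r : Colour) → p ≢ c → q ≢ c → r ≢ c → p ≡ q ⊎ p ≡ r ⊎ q ≡ r
  two-of-three = from-yes (all? {n = 3} λ c → all? {n = 3} λ p → all? {n = 3} λ q → all? {n = 3} λ r →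
    ¬? (p ≟ c) →-dec (¬? (q ≟ c) →-dec (¬? (r ≟ c) →-dec
    (p ≟ q ⊎-dec (p ≟ r ⊎-dec q ≟ r)))))

-- The diagonal carries no colour, so col u v ≡ just c entails u ≢ v.
record GallaiColouring (n : ℕ) : Set where
  field
    col         : Fin n → Fin n → Maybe Colour
    col-sym     : ∀ u v → col u v ≡ col v u
    col-diag    : ∀ u → col u u ≡ nothing
    col-edge    : ∀ {u v} → u ≢ v → ∃ λ c → col u v ≡ just c
    not-rainbow : ∀ {u v w c d e} → Palette c d e →
                  col u v ≡ just c → col u w ≡ just d → col v w ≢ just e

  _─[_]─_ : Fin n → Colour → Fin n → Set
  u ─[ c ]─ v = col u v ≡ just c

  edge? : ∀ c u → Decidable (u ─[ c ]─_)
  edge? c u v = ≡-dec _≟_ (col u v) (just c)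

  edge-sym : ∀ {c u v} → u ─[ c ]─ v → v ─[ c ]─ u
  edge-sym = trans (col-sym _ _)

  edge-irrefl : ∀ {c u} → ¬ u ─[ c ]─ u
  edge-irrefl e with trans (sym (col-diag _)) e
  ... | ()

  edge-≢ : ∀ {c u v} → u ─[ c ]─ v → u ≢ v
  edge-≢ e refl = edge-irrefl e

  edge-unique : ∀ {c d u v} → u ─[ c ]─ v → u ─[ d ]─ v → c ≡ d
  edge-unique e f = just-injective (trans (sym e) f)

  recolour : ∀ {c d u v} → c ≡ d → u ─[ c ]─ v → u ─[ d ]─ v
  recolour refl e = e

  one-of : ∀ {c d e u v} → Palette c d e → u ≢ v →
           u ─[ c ]─ v ⊎ u ─[ d ]─ v ⊎ u ─[ e ]─ v
  one-of {c} {d} {e} (palette c≢d c≢e d≢e) u≢v with col-edge u≢v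
  ... | x , uv with x ≟ c | x ≟ d | x ≟ e
  ... | yes refl | _        | _        = inj₁ uv
  ... | no _     | yes refl | _        = inj₂ (inj₁ uv)
  ... | no _     | no _     | yes refl = inj₂ (inj₂ uv)
  ... | no x≢c   | no x≢d   | no x≢e   with two-of-three x c d e (≢-sym x≢c) (≢-sym x≢d) (≢-sym x≢e)
  ... | inj₁ eq        = contradiction eq c≢d
  ... | inj₂ (inj₁ eq) = contradiction eq c≢e
  ... | inj₂ (inj₂ eq) = contradiction eq d≢e

  comps : ∀ c → Components (_─[ c ]─_)
  comps c = components (edge? c) edge-sym

  comp : Colour → Fin n → ℕ
  comp c = label (comps c)

  comp-edge : ∀ {c u v} → u ─[ c ]─ v → comp c u ≡ comp c v
  comp-edge {c} = sound (comps c)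

  cross : ∀ {c u v} → comp c u ≢ comp c v → ∃ λ d → c ≢ d × u ─[ d ]─ v
  cross {c} {u} {v} u≁v with col-edge (λ u≡v → u≁v (cong (comp c) u≡v))
  ... | d , uv = d , (λ { refl → u≁v (comp-edge uv) }) , uv

  -- Along a c-edge in a component not containing v the colour seen from v cannot change.
  homogeneous : ∀ {c d u u′ v} → comp c u ≡ comp c u′ → comp c v ≢ comp c u →
                v ─[ d ]─ u → v ─[ d ]─ u′
  homogeneous {c} {d} {u} {u′} {v} u~u′ v≁u vu = walk (complete (comps c) u~u′) v≁u vu
    where
    walk : ∀ {u} → Star (_─[ c ]─_) u u′ → comp c v ≢ comp c u → v ─[ d ]─ u → v ─[ d ]─ u′
    walk ε _ vu = vu
    walk {u} (_◅_ {j = w} uw path) v≁u vu = walk path v≁w vw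
      where
      v≁w : comp c v ≢ comp c w
      v≁w v~w = v≁u (trans v~w (sym (comp-edge uw)))
      vw : v ─[ d ]─ w
      vw with cross v≁w
      ... | e , c≢e , ve with d ≟ e
      ... | yes refl = ve
      ... | no d≢e = contradiction uw
        (not-rainbow (palette d≢e (λ { refl → v≁u (comp-edge vu) }) (c≢e ∘ sym)) vu ve)

  isolated : ∀ {c u v} → (∀ w → ¬ u ─[ c ]─ w) → u ≢ v → comp c u ≢ comp c v
  isolated {c} iso u≢v eq with complete (comps c) eq
  ... | ε     = u≢v refl
  ... | r ◅ _ = iso _ r

module _ where
  open GallaiColouring

  restrict : (f : Fin m → Fin n) → Injective _≡_ _≡_ f → GallaiColouring n → GallaiColouring m
  restrict f f-inj G = record
    { col         = λ u v → col G (f u) (f v)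
    ; col-sym     = λ u v → col-sym G (f u) (f v)
    ; col-diag    = λ u → col-diag G (f u)
    ; col-edge    = λ u≢v → col-edge G (u≢v ∘ f-inj)
    ; not-rainbow = not-rainbow G
    }

  Disconnected : GallaiColouring n → Colour → Set
  Disconnected G c = ∃₂ λ u v → comp G c u ≢ comp G c v

  opaque
    -- Induction on the vertices. Without `zero` some colour `c` is disconnected; if `zero`
    -- reconnects it, then `zero` has no edge in one of the other two colours and is isolated there.
    gallai : (G : GallaiColouring (2 + n)) → ∃ (Disconnected G)
    gallai {zero} G with col-edge G {zero} {suc zero} (λ ())
    ... | c , 01c with third c c
    ... | d , d≢c , _ = d , zero , suc zero , isolated G iso λ ()
      where
      iso : ∀ w → ¬ _─[_]─_ G zero d w
      iso zero       e = edge-irrefl G e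
      iso (suc zero) e = d≢c (edge-unique G e 01c)
    gallai {suc n} G with gallai (restrict suc suc-injective G)
    ... | c , p , q , p≁q with palette-of c
    ... | d , e , palette c≢d c≢e d≢e = result
      where
      G⁻ : GallaiColouring (2 + n)
      G⁻ = restrict suc suc-injective G
      Touched : Fin (2 + n) → Set
      Touched u = ∃ λ w → _─[_]─_ G zero c (suc w) × comp G⁻ c w ≡ comp G⁻ c u
      -- Looks at the last visit of the path to `zero`: the stretch after it stays in one component
      -- of the rest.
      touch : ∀ {x u} → Star (λ u v → _─[_]─_ G u c v) x (suc u) →
              Touched u ⊎ (∃ λ w → x ≡ suc w × comp G⁻ c w ≡ comp G⁻ c u)
      touch {u = u} ε = inj₂ (u , refl , refl)
      touch {x} (r ◅ path) with touch path
      ... | inj₁ t = inj₁ t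
      touch {zero}  (r ◅ path) | inj₂ (w , refl , w~u) = inj₁ (w , r , w~u)
      touch {suc x} (r ◅ path) | inj₂ (w , refl , w~u) = inj₂ (x , refl , trans (comp-edge G⁻ r) w~u)
      -- By connectedness the component of `j` contains a `c`-neighbour `t` of `zero`. In the
      -- triangle on `zero`, `w`, `t` the edge `wt` is not `c`, so it repeats `a`, and `homogeneous`
      -- carries this to `j`.
      spread : ∀ {a w j} → (∀ u → comp G c zero ≡ comp G c (suc u)) → c ≢ a →
               _─[_]─_ G zero a (suc w) → comp G⁻ c w ≢ comp G⁻ c j → _─[_]─_ G⁻ w a j
      spread {a} {w} {j} conn c≢a 0w w≁j with touch (complete (comps G c) (conn j))
      ... | inj₁ (t , 0t , t~j) = homogeneous G⁻ t~j w≁t wt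
        where
        w≁t : comp G⁻ c w ≢ comp G⁻ c t
        w≁t w~t = w≁j (trans w~t t~j)
        wt : _─[_]─_ G⁻ w a t
        wt with cross G⁻ w≁t
        ... | x , c≢x , wx with a ≟ x
        ... | yes refl = wx
        ... | no a≢x = contradiction wx (not-rainbow G (palette (c≢a ∘ sym) a≢x c≢x) 0w 0t)
      -- If `w` and `w′` lie in different components, `spread` gives their edge both colours.
      -- Otherwise `p` or `q` lies in another component, and its edge to `w′` gets both colours.
      clash : ∀ {w w′} → (∀ u → comp G c zero ≡ comp G c (suc u)) →
              _─[_]─_ G zero d (suc w) → ¬ _─[_]─_ G zero e (suc w′)
      clash {w} {w′} conn 0w 0w′ with comp G⁻ c w ℕ.≟ comp G⁻ c w′
      ... | no w≁w′ = d≢e (edge-unique G⁻ (spread conn c≢d 0w w≁w′)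
                            (edge-sym G⁻ (spread conn c≢e 0w′ (w≁w′ ∘ sym))))
      ... | yes w~w′ with comp G⁻ c w ℕ.≟ comp G⁻ c p
      ... | no w≁p = d≢e (edge-unique G⁻
        (homogeneous G⁻ w~w′ (w≁p ∘ sym) (edge-sym G⁻ (spread conn c≢d 0w w≁p)))
        (edge-sym G⁻ (spread conn c≢e 0w′ (w≁p ∘ trans w~w′))))
      ... | yes w~p = d≢e (edge-unique G⁻
        (homogeneous G⁻ w~w′ (w≁q ∘ sym) (edge-sym G⁻ (spread conn c≢d 0w w≁q)))
        (edge-sym G⁻ (spread conn c≢e 0w′ (w≁q ∘ trans w~w′))))
        where
        w≁q : comp G⁻ c w ≢ comp G⁻ c q
        w≁q w~q = p≁q (trans (sym w~p) w~q)
      apart : ∀ a → (∀ w → ¬ _─[_]─_ G zero a w) → ∃ (Disconnected G)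
      apart a iso = a , zero , suc zero , isolated G iso λ ()
      result : ∃ (Disconnected G)
      result with all? (λ u → comp G c zero ℕ.≟ comp G c (suc u))
      ... | no ¬conn with ¬∀⟶∃¬ _ _ (λ u → comp G c zero ℕ.≟ comp G c (suc u)) ¬conn
      ... | u , 0≁u = c , zero , suc u , 0≁u
      result | yes conn with any? (edge? G d zero) | any? (edge? G e zero)
      ... | no ¬0w | _ = apart d λ w 0w → ¬0w (w , 0w)
      ... | yes _ | no ¬0w = apart e λ w 0w → ¬0w (w , 0w)
      ... | yes (zero , 0w) | yes _ = contradiction 0w (edge-irrefl G)
      ... | yes (suc _ , _) | yes (zero , 0w) = contradiction 0w (edge-irrefl G)
      ... | yes (suc _ , 0w) | yes (suc _ , 0w′) = contradiction 0w′ (clash conn 0w)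

-- Upper bound

module Analysis (G : GallaiColouring n) where
  open GallaiColouring G

  reach? : ∀ c u v → Decidable _
  reach? c u v = edge? c u ∪? edge? c v

  comp? : ∀ c u → Decidable (λ z → comp c z ≡ comp c u)
  comp? c u z = comp c z ℕ.≟ comp c u

  deg size : Colour → Fin n → ℕ
  deg c u = # (edge? c u)
  size c u = # (comp? c u)

  -- For an edge `uv` not of colour `c`, the vertices other than `u` and `v` that are not counted
  -- are the pages on `uv` that avoid `c`.
  reach : Colour → Fin n → Fin n → ℕ
  reach c u v = # (reach? c u v)

  reach≤deg+deg : ∀ c u v → reach c u v ≤ deg c u + deg c v
  reach≤deg+deg c u v = #-cover (reach? c u v) (edge? c u) (edge? c v) (λ x → x)

  deg<size : ∀ c u → deg c u < size c u
  deg<size c u = ≤-trans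
    (+-mono-≤ (1≤# u) (ℕ.m≤m+n (deg c u) 0))
    (pack-⊆ (comp? c u) ((-, (_≟ u)) ∷ (-, edge? c u) ∷ [])
      (cong (comp c) ∷ (sym ∘ comp-edge) ∷ [])
      (((λ { refl → edge-irrefl }) ∷ []) ∷ [] ∷ []))

  homogeneous₂ : ∀ {c d u u′ v v′} → comp c u ≡ comp c u′ → comp c v ≡ comp c v′ →
                 comp c u ≢ comp c v → u ─[ d ]─ v → u′ ─[ d ]─ v′
  homogeneous₂ u~u′ v~v′ u≁v uv =
    homogeneous v~v′ (λ u′~v → u≁v (trans u~u′ u′~v))
      (edge-sym (homogeneous u~u′ (u≁v ∘ sym) (edge-sym uv)))

-- Four components of one colour

module FourComponents
  -- Two cases are used: `k` = 6 for all 17 vertices, and `k` = 5 for the 16 vertices left when the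
  -- apex of a cone in colour `c` is deleted, which lowers the bound for `c` by one.
  {k : ℕ} (G : GallaiColouring (11 + k)) (5≤k : 5 ≤ k) (c : Colour)
  (off : ∀ {u v d} → c ≢ d → GallaiColouring._─[_]─_ G u d v → k ≤ Analysis.reach G c u v)
  (on  : ∀ {u v d} → c ≢ d → GallaiColouring._─[_]─_ G u c v → 6 ≤ Analysis.reach G d u v)
  where
  open GallaiColouring G
  open Analysis G

  Apart : Fin (11 + k) → Fin (11 + k) → Set
  Apart u v = comp c u ≢ comp c v

  deg-sum : ∀ {u v} → Apart u v → k ≤ deg c u + deg c v
  deg-sum {u} {v} u≁v with cross u≁v
  ... | d , c≢d , uv = ≤-trans (off c≢d uv) (reach≤deg+deg c u v)

  -- Each component exceeds the degree of its vertex, so two of them have at least `k + 2` vertices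
  -- and ten more do not fit. The trailing `0` ends the sum formed by `pack`.
  overfull : ∀ {u v s t} → Apart u v → size c u + (size c v + (s + (t + 0))) ≤ 11 + k →
             ¬ 10 ≤ s + (t + 0)
  overfull {u} {v} {s} {t} u≁v sum≤ 10≤ = 1+n≰n (begin
    12 + k                                      ≡⟨ cong (2 +_) (+-comm 10 k) ⟩
    suc (suc k) + 10                            ≤⟨ +-mono-≤ (s≤s (s≤s (deg-sum u≁v))) ≤-refl ⟩
    suc (suc (deg c u + deg c v)) + 10          ≡⟨ cong (λ i → suc i + 10) (ℕ.+-suc (deg c u) (deg c v)) ⟨
    suc (deg c u) + suc (deg c v) + 10          ≤⟨ +-mono-≤ (+-mono-≤ (deg<size c u) (deg<size c v)) 10≤ ⟩
    size c u + size c v + (s + (t + 0))         ≡⟨ +-assoc (size c u) (size c v) (s + (t + 0)) ⟩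
    size c u + (size c v + (s + (t + 0)))       ≤⟨ sum≤ ⟩
    11 + k                                      ∎)
    where open ℕ.≤-Reasoning

  comps-disjoint : ∀ {u v} → Apart u v → Disjoint (-, comp? c u) (-, comp? c v)
  comps-disjoint u≁v z~u z~v = u≁v (trans (sym z~u) z~v)

  -- Otherwise `v`, `z` and three neighbours of `v` would be five vertices of the component.
  clique : ∀ {u v z} → size c u ≤ 4 → comp c v ≡ comp c u → 3 ≤ deg c v →
           comp c z ≡ comp c u → z ≢ v → v ─[ c ]─ z
  clique {u} {v} {z} size≤4 v~u 3≤deg z~u z≢v with edge? c v z
  ... | yes vz = vz
  ... | no ¬vz = contradiction
    (≤-trans (≤-trans (+-mono-≤ (1≤# v) (+-mono-≤ (1≤# z) (+-mono-≤ 3≤deg (z≤n {0}))))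
      (pack-⊆ (comp? c u) ((-, (_≟ v)) ∷ (-, (_≟ z)) ∷ (-, edge? c v) ∷ [])
        ((λ { refl → v~u }) ∷ (λ { refl → z~u }) ∷ (λ vw → trans (sym (comp-edge vw)) v~u) ∷ [])
        (((λ { refl refl → z≢v refl }) ∷ (λ { refl → edge-irrefl }) ∷ []) ∷
         ((λ { refl → ¬vz }) ∷ []) ∷ [] ∷ [])))
      size≤4)
    (from-no (5 ≤? 4))

  -- A component of size at most 4 would be a c-clique on N[u] = N[u′]; with the components of
  -- a and b and the vertices reached from u or u′ in the third colour it would overfill the graph.
  big : ∀ {u u′ a b d} → u ─[ c ]─ u′ → 3 ≤ deg c u → 3 ≤ deg c u′ →
        Apart u a → Apart u b → Apart a b → u ─[ d ]─ a → u ─[ d ]─ b → 5 ≤ size c u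
  big {u} {u′} {a} {b} {d} uu′ 3≤u 3≤u′ u≁a u≁b a≁b ua ub with 5 ≤? size c u
  ... | yes 5≤ = 5≤
  ... | no 5≰ with complete-palette {c} {d} (λ { refl → u≁a (comp-edge ua) })
  ... | e , palette c≢d c≢e d≢e = ⊥-elim (overfull {s = size c u} {t = reach e u u′} a≁b
    (pack ((-, comp? c a) ∷ (-, comp? c b) ∷ (-, comp? c u) ∷ (-, reach? e u u′) ∷ [])
      ((comps-disjoint a≁b ∷ comps-disjoint (u≁a ∘ sym) ∷ outside u≁a ua ∷ []) ∷
       (comps-disjoint (u≁b ∘ sym) ∷ outside u≁b ub ∷ []) ∷
       (inside ∷ []) ∷ [] ∷ []))
    (+-mono-≤ (≤-trans (s≤s 3≤u) (deg<size c u)) (+-mono-≤ (on c≢e uu′) (z≤n {0}))))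
    where
    size≤4 : size c u ≤ 4
    size≤4 = s≤s⁻¹ (≰⇒> 5≰)
    u~u′ : comp c u ≡ comp c u′
    u~u′ = comp-edge uu′
    outside : ∀ {w} → Apart u w → u ─[ d ]─ w → Disjoint (-, comp? c w) (-, reach? e u u′)
    outside u≁w uw z~w (inj₁ uz)  = d≢e (edge-unique (homogeneous₂ refl (sym z~w) u≁w uw) uz)
    outside u≁w uw z~w (inj₂ u′z) = d≢e (edge-unique (homogeneous₂ u~u′ (sym z~w) u≁w uw) u′z)
    inside : Disjoint (-, comp? c u) (-, reach? e u u′)
    inside z~u (inj₁ uz) =
      c≢e (edge-unique (clique size≤4 refl 3≤u z~u (edge-≢ uz ∘ sym)) uz)
    inside z~u (inj₂ u′z) =
      c≢e (edge-unique (clique size≤4 (sym u~u′) 3≤u′ z~u (edge-≢ u′z ∘ sym)) u′z)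

  Low : Fin (11 + k) → Set
  Low u = ∃ λ v → comp c v ≡ comp c u × deg c v ≤ 2

  -- Two vertices of degree at most 2 in different components would violate `deg-sum`.
  low-unique : ∀ {u v} → Apart u v → Low u → ¬ Low v
  low-unique u≁v (u′ , u′~u , du) (v′ , v′~v , dv) = contradiction
    (≤-trans 5≤k (≤-trans (deg-sum (λ eq → u≁v (trans (sym u′~u) (trans eq v′~v)))) (+-mono-≤ du dv)))
    (from-no (5 ≤? 4))

  -- If `u` and a `c`-neighbour both have degree at least 3, two of the three other components are
  -- seen from `u` in the same colour, as `big` requires.
  big-or-low : ∀ {u} (x : Fin 3 → Fin (11 + k)) → (∀ i → Apart u (x i)) →
               (∀ i j → i ≢ j → Apart (x i) (x j)) → 5 ≤ size c u ⊎ Low u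
  big-or-low {u} x u≁x x-apart with 3 ≤? deg c u
  ... | no 3≰u = inj₂ (u , refl , s≤s⁻¹ (≰⇒> 3≰u))
  ... | yes 3≤u with enumerate 1 (edge? c u) (≤-trans (s≤s z≤n) 3≤u)
  ... | f , _ , uf with 3 ≤? deg c (f zero)
  ... | no 3≰u′ = inj₂ (f zero , sym (comp-edge (uf zero)) , s≤s⁻¹ (≰⇒> 3≰u′))
  ... | yes 3≤u′ with cross (u≁x 0F) | cross (u≁x 1F) | cross (u≁x 2F)
  ... | p , c≢p , u0 | q , c≢q , u1 | r , c≢r , u2
    with two-of-three c p q r (c≢p ∘ sym) (c≢q ∘ sym) (c≢r ∘ sym)
  ... | inj₁ refl        = inj₁ (big (uf zero) 3≤u 3≤u′ (u≁x 0F) (u≁x 1F) (x-apart 0F 1F λ ()) u0 u1)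
  ... | inj₂ (inj₁ refl) = inj₁ (big (uf zero) 3≤u 3≤u′ (u≁x 0F) (u≁x 2F) (x-apart 0F 2F λ ()) u0 u2)
  ... | inj₂ (inj₂ refl) = inj₁ (big (uf zero) 3≤u 3≤u′ (u≁x 1F) (u≁x 2F) (x-apart 1F 2F λ ()) u1 u2)

  -- The remaining two components supply the `k + 2` vertices of `overfull`.
  two-big : ∀ (x : Fin 4 → Fin (11 + k)) → (∀ i j → i ≢ j → Apart (x i) (x j)) →
            ∀ i j k l → AllPairs _≢_ (i ∷ j ∷ k ∷ l ∷ []) → 5 ≤ size c (x k) → ¬ 5 ≤ size c (x l)
  two-big x x-apart i j k l ((ij ∷ ik ∷ il ∷ []) ∷ (jk ∷ jl ∷ []) ∷ (kl ∷ []) ∷ [] ∷ []) 5≤k 5≤l =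
    overfull {s = size c (x k)} {t = size c (x l)} (x-apart i j ij)
      (pack ((-, comp? c (x i)) ∷ (-, comp? c (x j)) ∷ (-, comp? c (x k)) ∷ (-, comp? c (x l)) ∷ [])
        ((dis ij ∷ dis ik ∷ dis il ∷ []) ∷ (dis jk ∷ dis jl ∷ []) ∷ (dis kl ∷ []) ∷ [] ∷ []))
      (+-mono-≤ 5≤k (+-mono-≤ 5≤l (z≤n {0})))
    where
    dis : ∀ {i j} → i ≢ j → Disjoint (-, comp? c (x i)) (-, comp? c (x j))
    dis i≢j = comps-disjoint (x-apart _ _ i≢j)

  -- Pigeonhole on three of the components: two are big or two are low. The fourth ensures that each
  -- of them sees three others.
  not-four : (x : Fin 4 → Fin (11 + k)) → ¬ (∀ i j → i ≢ j → Apart (x i) (x j))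
  not-four x x-apart = cases (split 0F) (split 1F) (split 2F)
    where
    split : ∀ i → 5 ≤ size c (x i) ⊎ Low (x i)
    split i = big-or-low (x ∘ punchIn i) (λ j → x-apart i (punchIn i j) (≢-sym (punchInᵢ≢i i j)))
      (λ j k j≢k → x-apart (punchIn i j) (punchIn i k) (j≢k ∘ punchIn-injective i j k))
    distinct? : (is : List (Fin 4)) → Dec (AllPairs _≢_ is)
    distinct? = allPairs? λ i j → ¬? (i ≟ j)
    cases : 5 ≤ size c (x 0F) ⊎ Low (x 0F) → 5 ≤ size c (x 1F) ⊎ Low (x 1F) →
            5 ≤ size c (x 2F) ⊎ Low (x 2F) → ⊥
    cases (inj₁ b₀) (inj₁ b₁) _         = two-big x x-apart 2F 3F 0F 1F (from-yes (distinct? (2F ∷ 3F ∷ 0F ∷ 1F ∷ []))) b₀ b₁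
    cases (inj₁ b₀) (inj₂ _)  (inj₁ b₂) = two-big x x-apart 1F 3F 0F 2F (from-yes (distinct? (1F ∷ 3F ∷ 0F ∷ 2F ∷ []))) b₀ b₂
    cases (inj₂ _)  (inj₁ b₁) (inj₁ b₂) = two-big x x-apart 0F 3F 1F 2F (from-yes (distinct? (0F ∷ 3F ∷ 1F ∷ 2F ∷ []))) b₁ b₂
    cases (inj₂ l₀) (inj₂ l₁) _         = low-unique (x-apart 0F 1F λ ()) l₀ l₁
    cases (inj₂ l₀) _         (inj₂ l₂) = low-unique (x-apart 0F 2F λ ()) l₀ l₂
    cases _         (inj₂ l₁) (inj₂ l₂) = low-unique (x-apart 1F 2F λ ()) l₁ l₂

-- Cuts joined in one colour

module _ (G : GallaiColouring n) where
  open GallaiColouring G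
  open Analysis G

  record Cut (d : Colour) : Set₁ where
    field
      {Side}  : Pred (Fin n) 0ℓ
      side?   : Decidable Side
      {in-pt} : Fin n
      {out-pt} : Fin n
      in-∈    : Side in-pt
      out-∉   : ¬ Side out-pt
      across  : ∀ {a b} → Side a → ¬ Side b → a ─[ d ]─ b

  FourApart : Colour → Set
  FourApart c = Σ[ x ∈ (Fin 4 → Fin n) ] (∀ i j → i ≢ j → comp c (x i) ≢ comp c (x j))

  -- A component whose at most two neighbouring components are seen in one colour.
  star-cut : ∀ {c d p q r} → comp c p ≢ comp c q → comp c p ≢ comp c r →
             p ─[ d ]─ q → p ─[ d ]─ r →
             (∀ z → comp c z ≢ comp c p → comp c z ≢ comp c q → ¬ comp c z ≢ comp c r) → Cut d
  star-cut {c} {d} {p} {q} {r} p≁q p≁r pq pr cover = record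
    { side? = comp? c p ; in-∈ = refl ; out-∉ = p≁q ∘ sym ; across = across }
    where
    across : ∀ {a b} → comp c a ≡ comp c p → comp c b ≢ comp c p → a ─[ d ]─ b
    across {a} {b} a~p b≁p with comp? c q b
    ... | yes b~q = homogeneous₂ (sym a~p) (sym b~q) p≁q pq
    ... | no b≁q  = homogeneous₂ (sym a~p) (sym (decidable-stable (comp? c r b) (cover b b≁p b≁q))) p≁r pr

  -- Two components form a cut at once. With three, the colours between them differ from `c`, so two
  -- of these colours agree, and the component common to both pairs is one side.
  decompose : ∀ {c} → Disconnected G c → FourApart c ⊎ (∃ λ d → c ≢ d × Cut d)
  decompose {c} (u , v , u≁v)
    with any? (λ w → ¬? (comp? c u w) ×-dec ¬? (comp? c v w)) | cross u≁v
  ... | no ¬third | d , c≢d , uv =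
    inj₂ (d , c≢d , star-cut u≁v u≁v uv uv λ z z≁u z≁v _ → ¬third (z , z≁u , z≁v))
  ... | yes (w , w≁u , w≁v) | d , c≢d , uv
    with any? (λ t → ¬? (comp? c u t) ×-dec (¬? (comp? c v t) ×-dec ¬? (comp? c w t)))
  ... | yes (t , t≁u , t≁v , t≁w) = inj₁ (x , x-apart)
    where
    x : Fin 4 → Fin n
    x 0F = u
    x 1F = v
    x 2F = w
    x 3F = t
    x-apart : ∀ i j → i ≢ j → comp c (x i) ≢ comp c (x j)
    x-apart 0F 0F i≢i = contradiction refl i≢i
    x-apart 0F 1F _   = u≁v
    x-apart 0F 2F _   = w≁u ∘ sym
    x-apart 0F 3F _   = t≁u ∘ sym
    x-apart 1F 0F _   = u≁v ∘ sym
    x-apart 1F 1F i≢i = contradiction refl i≢i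
    x-apart 1F 2F _   = w≁v ∘ sym
    x-apart 1F 3F _   = t≁v ∘ sym
    x-apart 2F 0F _   = w≁u
    x-apart 2F 1F _   = w≁v
    x-apart 2F 2F i≢i = contradiction refl i≢i
    x-apart 2F 3F _   = t≁w ∘ sym
    x-apart 3F 0F _   = t≁u
    x-apart 3F 1F _   = t≁v
    x-apart 3F 2F _   = t≁w
    x-apart 3F 3F i≢i = contradiction refl i≢i
  ... | no ¬fourth with cross (w≁u ∘ sym) | cross (w≁v ∘ sym)
  ... | e , c≢e , uw | f , c≢f , vw
    with two-of-three c d e f (c≢d ∘ sym) (c≢e ∘ sym) (c≢f ∘ sym)
  ... | inj₁ refl        = inj₂ (d , c≢d , star-cut u≁v (w≁u ∘ sym) uv uw
                             λ z z≁u z≁v z≁w → ¬fourth (z , z≁u , z≁v , z≁w))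
  ... | inj₂ (inj₁ refl) = inj₂ (d , c≢d , star-cut (u≁v ∘ sym) (w≁v ∘ sym) (edge-sym uv) vw
                             λ z z≁v z≁u z≁w → ¬fourth (z , z≁u , z≁v , z≁w))
  ... | inj₂ (inj₂ refl) = inj₂ (e , c≢e , star-cut w≁u w≁v (edge-sym uw) (edge-sym vw)
                             λ z z≁w z≁u z≁v → ¬fourth (z , z≁u , z≁v , z≁w))

-- Deleting the apex of a cone

module Cone
  (G : GallaiColouring 16) (r : Colour)
  -- The deleted apex has only `r`-edges. In another colour `d` it is never reached, and the
  -- `d`-reach of a spoke is the `d`-degree of its other end; in `r` it is always reached, which
  -- costs one in `reach-r≥`.
  (deg≥ : ∀ {d} → r ≢ d → ∀ u → 6 ≤ Analysis.deg G d u)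
  (reach≥ : ∀ {d x u v} → r ≢ d → d ≢ x → GallaiColouring._─[_]─_ G u x v → 6 ≤ Analysis.reach G d u v)
  (reach-r≥ : ∀ {x u v} → r ≢ x → GallaiColouring._─[_]─_ G u x v → 5 ≤ Analysis.reach G r u v)
  where
  open GallaiColouring G
  open Analysis G

  -- A vertex joined to one end in `e` and to the other in `r` would complete a rainbow triangle. So
  -- the two `e`-neighbourhoods and the `r`-reach are disjoint, and 6 + 6 + 5 > 16.
  impossible-edge : ∀ {d e u v} → Palette r d e → u ─[ d ]─ v →
                    Disjoint (-, edge? e u) (-, edge? e v) → ⊥
  impossible-edge {d} {e} {u} {v} pal@(palette r≢d r≢e d≢e) uv dis = contradiction
    (≤-trans (+-mono-≤ (deg≥ r≢e u) (+-mono-≤ (deg≥ r≢e v) (+-mono-≤ (reach-r≥ r≢d uv) (z≤n {0}))))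
      (pack ((-, edge? e u) ∷ (-, edge? e v) ∷ (-, reach? r u v) ∷ [])
        ((dis ∷ from-u ∷ []) ∷ (from-v ∷ []) ∷ [] ∷ [])))
    (from-no (17 ≤? 16))
    where
    from-u : Disjoint (-, edge? e u) (-, reach? r u v)
    from-u uz (inj₁ uz′) = r≢e (edge-unique uz′ uz)
    from-u uz (inj₂ vz)  = not-rainbow (pal-rotate pal) uv uz vz
    from-v : Disjoint (-, edge? e v) (-, reach? r u v)
    from-v vz (inj₁ uz)  = not-rainbow (pal-rotate pal) (edge-sym uv) vz uz
    from-v vz (inj₂ vz′) = r≢e (edge-unique vz′ vz)

  impossible : ⊥
  impossible with gallai G
  ... | c , u , v , u≁v with r ≟ c
  ... | no r≢c = apart (cross u≁v)
    where
    apart : ¬ (∃ λ d → c ≢ d × u ─[ d ]─ v)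
    apart (x , c≢x , uv) with r ≟ x
    -- A common `c`-neighbour would put `u` and `v` in one component.
    ... | no r≢x = impossible-edge (palette r≢x r≢c (c≢x ∘ sym)) uv
      λ uz vz → u≁v (trans (comp-edge uz) (sym (comp-edge vz)))
    ... | yes refl with complete-palette r≢c
    -- The component of `v` has at least 7 vertices, contains no `c`-neighbour of `u` and is joined
    -- to `u` in `r`, so it contains no `e`-neighbour of `u` either: 6 + 6 + 7 > 16.
    ... | e , palette _ r≢e c≢e = contradiction
      (≤-trans
        (+-mono-≤ (deg≥ r≢c u) (+-mono-≤ (deg≥ r≢e u)
          (+-mono-≤ (≤-trans (s≤s (deg≥ r≢c v)) (deg<size c v)) (z≤n {0}))))
        (pack ((-, edge? c u) ∷ (-, edge? e u) ∷ (-, comp? c v) ∷ [])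
          (((λ uz uz′ → c≢e (edge-unique uz uz′)) ∷ (λ uz z~v → u≁v (trans (comp-edge uz) z~v)) ∷ []) ∷
           ((λ uz z~v → r≢e (edge-unique (homogeneous₂ refl (sym z~v) u≁v uv) uz)) ∷ []) ∷ [] ∷ [])))
      (from-no (19 ≤? 16))
  ... | yes refl with decompose G (u , v , u≁v)
  ... | inj₁ (x , x-apart) = FourComponents.not-four {5} G ≤-refl r
    reach-r≥ (λ r≢d → reach≥ r≢d (r≢d ∘ sym)) x x-apart
  ... | inj₂ (d , r≢d , cut) with complete-palette r≢d
  -- A common `e`-neighbour would lie on one side of the cut and be joined in `d` to the end on the
  -- other side.
  ... | e , pal@(palette _ _ d≢e) = impossible-edge pal (across in-∈ out-∉) dis
    where
    open Cut cut
    dis : Disjoint (-, edge? e in-pt) (-, edge? e out-pt)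
    dis {z} in-z out-z with side? z
    ... | yes z∈ = d≢e (edge-unique (across z∈ out-∉) (edge-sym out-z))
    ... | no z∉  = d≢e (edge-unique (across in-∈ z∉) in-z)

-- Colourings of 17 vertices without the book

module Bookless
  (G : GallaiColouring 17)
  (reach≥ : ∀ {d x u v} → d ≢ x → GallaiColouring._─[_]─_ G u x v → 6 ≤ Analysis.reach G d u v)
  where
  open GallaiColouring G
  open Analysis G

  cone-free : ∀ {r} y → ¬ (∀ z → z ≢ y → y ─[ r ]─ z)
  cone-free {r} y cone = Cone.impossible (restrict (punchIn y) (punchIn-injective y _ _) G) r
    (λ r≢d u → ≤-trans (reach≥ (r≢d ∘ sym) (spoke u)) (≤-trans
      (#-punchIn-∉ (reach? _ y (punchIn y u)) y
        [ edge-irrefl , r≢d ∘ edge-unique (edge-sym (spoke u)) ])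
      (#-mono (reach? _ y (punchIn y u) ∘ punchIn y) (edge? _ (punchIn y u) ∘ punchIn y)
        λ { {z} (inj₁ yz) → contradiction (edge-unique (spoke z) yz) r≢d ; (inj₂ uz) → uz })))
    (λ {d} {x} {u} {v} r≢d d≢x uv → ≤-trans (reach≥ d≢x uv)
      (#-punchIn-∉ (reach? d (punchIn y u) (punchIn y v)) y
        [ r≢d ∘ edge-unique (edge-sym (spoke u)) , r≢d ∘ edge-unique (edge-sym (spoke v)) ]))
    (λ {x} {u} {v} r≢x uv → s≤s⁻¹ (≤-trans (reach≥ r≢x uv)
      (#-punchIn-≤ (reach? r (punchIn y u) (punchIn y v)) y)))
    where
    spoke : ∀ u → y ─[ r ]─ punchIn y u
    spoke u = cone (punchIn y u) (punchInᵢ≢i y u)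

  module SmallSide
    {r : Colour} {S : Pred (Fin 17) 0ℓ} (S? : Decidable S) (#S≤8 : # S? ≤ 8)
    (across : ∀ {a b} → S a → ¬ S b → a ─[ r ]─ b)
    where

    9≤#∁S : 9 ≤ # (∁? S?)
    9≤#∁S = +-cancelˡ-≤ 8 9 _ (≤-trans (#-complement S?) (+-mono-≤ #S≤8 ≤-refl))

    reach-inside : ∀ {d a b} → r ≢ d → S a → S b → ∀ {z} → a ─[ d ]─ z ⊎ b ─[ d ]─ z → S z
    reach-inside r≢d a∈ b∈ {z} reached with S? z | reached
    ... | yes z∈ | _       = z∈
    ... | no z∉  | inj₁ az = contradiction (edge-unique (across a∈ z∉) az) r≢d
    ... | no z∉  | inj₂ bz = contradiction (edge-unique (across b∈ z∉) bz) r≢d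

    -- The `d`- and `e`-reach of an `r`-edge are disjoint, as there is no rainbow triangle, and lie
    -- in `S`. With the outside, 9 + 6 + 6 > 17.
    no-r-edge : ∀ {a b} → S a → S b → ¬ a ─[ r ]─ b
    no-r-edge {a} {b} a∈ b∈ ab with palette-of r
    ... | d , e , pal@(palette r≢d r≢e d≢e) = contradiction
      (≤-trans (+-mono-≤ 9≤#∁S (+-mono-≤ (reach≥ (r≢d ∘ sym) ab) (+-mono-≤ (reach≥ (r≢e ∘ sym) ab) (z≤n {0}))))
        (pack ((-, ∁? S?) ∷ (-, reach? d a b) ∷ (-, reach? e a b) ∷ [])
          (((λ z∉ → z∉ ∘ reach-inside r≢d a∈ b∈) ∷ (λ z∉ → z∉ ∘ reach-inside r≢e a∈ b∈) ∷ []) ∷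
           (dis ∷ []) ∷ [] ∷ [])))
      (from-no (21 ≤? 17))
      where
      dis : Disjoint (-, reach? d a b) (-, reach? e a b)
      dis (inj₁ az) (inj₁ az′) = d≢e (edge-unique az az′)
      dis (inj₁ az) (inj₂ bz)  = not-rainbow pal ab az bz
      dis (inj₂ bz) (inj₁ az)  = not-rainbow (pal-swap pal) ab az bz
      dis (inj₂ bz) (inj₂ bz′) = d≢e (edge-unique bz bz′)

    module _ {d e} (pal : Palette r d e) where
      open Palette pal renaming (c≢d to r≢d; c≢e to r≢e)

      ≢-left : ∀ {a b z} → a ─[ d ]─ b → a ─[ e ]─ z ⊎ b ─[ e ]─ z → z ≢ a
      ≢-left ab (inj₁ aa) refl = edge-irrefl aa
      ≢-left ab (inj₂ ba) refl = d≢e (edge-unique ab (edge-sym ba))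

      ≢-right : ∀ {a b z} → a ─[ d ]─ b → a ─[ e ]─ z ⊎ b ─[ e ]─ z → z ≢ b
      ≢-right ab (inj₁ ab′) refl = d≢e (edge-unique ab ab′)
      ≢-right ab (inj₂ bb)  refl = edge-irrefl bb

      -- The `e`-reach has at least 6 vertices, all in `S`, and contains neither `a` nor `b`.
      8≤#S : ∀ {a b} → S a → S b → a ─[ d ]─ b → 8 ≤ # S?
      8≤#S {a} {b} a∈ b∈ ab = ≤-trans
        (+-mono-≤ (reach≥ (d≢e ∘ sym) ab) (+-mono-≤ (1≤# a) (+-mono-≤ (1≤# b) (z≤n {0}))))
        (pack-⊆ S? ((-, reach? e a b) ∷ (-, (_≟ a)) ∷ (-, (_≟ b)) ∷ [])
          (reach-inside r≢e a∈ b∈ ∷ (λ { refl → a∈ }) ∷ (λ { refl → b∈ }) ∷ [])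
          ((≢-left ab ∷ ≢-right ab ∷ []) ∷
           ((λ { refl refl → edge-irrefl ab }) ∷ []) ∷ [] ∷ []))

      -- The vertices `a`, `b` and their `e`-reach already fill `S`, which has at most 8 vertices.
      dominated : ∀ {a b w} → S a → S b → S w → a ─[ d ]─ b → w ≢ a → w ≢ b →
                  a ─[ e ]─ w ⊎ b ─[ e ]─ w
      dominated {a} {b} {w} a∈ b∈ w∈ ab w≢a w≢b with reach? e a b w
      ... | yes reached = reached
      ... | no ¬reached = contradiction
        (≤-trans (≤-trans
          (+-mono-≤ (reach≥ (d≢e ∘ sym) ab) (+-mono-≤ (1≤# a) (+-mono-≤ (1≤# b) (+-mono-≤ (1≤# w) (z≤n {0})))))
          (pack-⊆ S? ((-, reach? e a b) ∷ (-, (_≟ a)) ∷ (-, (_≟ b)) ∷ (-, (_≟ w)) ∷ [])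
            (reach-inside r≢e a∈ b∈ ∷ (λ { refl → a∈ }) ∷ (λ { refl → b∈ }) ∷ (λ { refl → w∈ }) ∷ [])
            ((≢-left ab ∷ ≢-right ab ∷ (λ { reached refl → ¬reached reached }) ∷ []) ∷
             ((λ { refl refl → edge-irrefl ab }) ∷ (λ { refl refl → w≢a refl }) ∷ []) ∷
             ((λ { refl refl → w≢b refl }) ∷ []) ∷ [] ∷ [])))
          #S≤8)
        (from-no (9 ≤? 8))

    -- Three d-neighbours of y would span an e-triangle, contradicting domination along one of its edges.
    deg≤2 : ∀ {d e y} → Palette r d e → S y → # (edge? d y ∩? S?) ≤ 2
    deg≤2 {d} {e} {y} pal y∈ with 3 ≤? # (edge? d y ∩? S?)
    ... | no 3≰ = s≤s⁻¹ (≰⇒> 3≰)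
    ... | yes 3≤ with enumerate 3 (edge? d y ∩? S?) 3≤
    ... | f , f-inj , f∈ = ⊥-elim
      ([ (λ ac → d≢e (edge-unique ac (side 0F 2F λ ()))) , (λ bc → d≢e (edge-unique bc (side 1F 2F λ ()))) ]
        (dominated (pal-swap pal) (proj₂ (f∈ 0F)) (proj₂ (f∈ 1F)) (proj₂ (f∈ 2F))
          (side 0F 1F λ ()) (f≢ 2F 0F λ ()) (f≢ 2F 1F λ ())))
      where
      open Palette pal
      f≢ : ∀ i j → i ≢ j → f i ≢ f j
      f≢ i j i≢j eq = i≢j (f-inj eq)
      side : ∀ i j → i ≢ j → f i ─[ e ]─ f j
      side i j i≢j with dominated pal y∈ (proj₂ (f∈ i)) (proj₂ (f∈ j)) (proj₁ (f∈ i))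
        (edge-≢ (proj₁ (f∈ j)) ∘ sym) (f≢ j i (i≢j ∘ sym))
      ... | inj₁ yj = contradiction (edge-unique (proj₁ (f∈ j)) yj) d≢e
      ... | inj₂ ij = ij

    -- Such an edge forces 8 vertices in `S`, but `y` has at most two neighbours there in each of
    -- `d` and `e` and none in `r`: 8 > 1 + 2 + 2.
    no-edge : ∀ {d e y z} → Palette r d e → S y → S z → ¬ y ─[ d ]─ z
    no-edge {d} {e} {y} {z} pal y∈ z∈ yz = contradiction
      (≤-trans (8≤#S pal y∈ z∈ yz) (≤-trans (#-remove S? y) (s≤s (≤-trans
        (#-cover (S? ∩? ∁? (_≟ y)) (edge? d y ∩? S?) (edge? e y ∩? S?) split)
        (+-mono-≤ (deg≤2 pal y∈) (deg≤2 (pal-swap pal) y∈))))))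
      (from-no (8 ≤? 5))
      where
      split : ∀ {w} → S w × w ≢ y → (y ─[ d ]─ w × S w) ⊎ (y ─[ e ]─ w × S w)
      split (w∈ , w≢y) with one-of pal (w≢y ∘ sym)
      ... | inj₁ yw        = contradiction yw (no-r-edge y∈ w∈)
      ... | inj₂ (inj₁ yw) = inj₁ (yw , w∈)
      ... | inj₂ (inj₂ yw) = inj₂ (yw , w∈)

    -- With `d` and `e` excluded inside `S`, and `across` applied outside, `y` would be the apex of
    -- an `r`-cone.
    empty : ∀ y → ¬ S y
    empty y y∈ = cone-free y cone
      where
      cone : ∀ z → z ≢ y → y ─[ r ]─ z
      cone z z≢y with S? z | palette-of r
      ... | no z∉ | _ = across y∈ z∉
      ... | yes z∈ | d , e , pal with one-of pal (z≢y ∘ sym)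
      ... | inj₁ yz        = yz
      ... | inj₂ (inj₁ yz) = contradiction yz (no-edge pal y∈ z∈)
      ... | inj₂ (inj₂ yz) = contradiction yz (no-edge (pal-swap pal) y∈ z∈)

  impossible : ⊥
  impossible with gallai G
  ... | c , disc with decompose G disc
  ... | inj₁ (x , x-apart) = FourComponents.not-four {6} G (ℕ.n≤1+n 5) c
    reach≥ (λ c≢d → reach≥ (c≢d ∘ sym)) x x-apart
  ... | inj₂ (d , _ , cut) with # (Cut.side? cut) ≤? 8
  ... | yes small = SmallSide.empty (Cut.side? cut) small (Cut.across cut) _ (Cut.in-∈ cut)
  -- As 17 = 9 + 8, the complement is now the small side; lying outside it is a double negation.
  ... | no large = SmallSide.empty (∁? side?)
    (+-cancelˡ-≤ 9 _ 8 (≤-trans (+-mono-≤ (≰⇒> large) ≤-refl)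
      (≤-trans (≤-reflexive (cong (# side? +_) (sym (ℕ.+-identityʳ _))))
        (pack ((-, side?) ∷ (-, ∁? side?) ∷ []) (((λ z∈ z∉ → z∉ z∈) ∷ []) ∷ [] ∷ [])))))
    (λ a∉ ¬¬b∈ → edge-sym (across (decidable-stable (side? _) ¬¬b∈) a∉)) _ out-∉
    where open Cut cut

-- From colourings to books

fromColoring : (f : Coloring 3 (K n)) → Gallai f → GallaiColouring n
fromColoring {n} f no-rainbow = record
  { col = col ; col-sym = col-sym ; col-diag = col-diag
  ; col-edge = λ u≢v → -, col-off u≢v ; not-rainbow = not-rainbow }
  where
  col : Fin n → Fin n → Maybe Colour
  col u v with u ≟ v
  ... | yes _  = nothing
  ... | no u≢v = just (colour f u v u≢v)
  col-off : ∀ {u v} (u≢v : u ≢ v) → col u v ≡ just (colour f u v u≢v)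
  col-off {u} {v} u≢v with u ≟ v
  ... | yes u≡v = contradiction u≡v u≢v
  ... | no _    = refl
  col-diag : ∀ u → col u u ≡ nothing
  col-diag u with u ≟ u
  ... | yes _  = refl
  ... | no u≢u = contradiction refl u≢u
  col-sym : ∀ u v → col u v ≡ col v u
  col-sym u v = case (u ≟ v)
    where
    case : Dec (u ≡ v) → col u v ≡ col v u
    case (yes refl) = refl
    case (no u≢v)   = trans (col-off u≢v)
      (trans (cong just (colour-sym f u v u≢v)) (sym (col-off (≢-sym u≢v))))
  off-diag : ∀ {u v c} → col u v ≡ just c → u ≢ v
  off-diag {u} uv refl with trans (sym (col-diag u)) uv
  ... | ()
  colour≡ : ∀ {u v c} (u≢v : u ≢ v) → col u v ≡ just c → colour f u v u≢v ≡ c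
  colour≡ u≢v uv = just-injective (trans (sym (col-off u≢v)) uv)
  not-rainbow : ∀ {u v w c d e} → Palette c d e →
                col u v ≡ just c → col u w ≡ just d → col v w ≢ just e
  not-rainbow {u} {v} {w} (palette c≢d c≢e d≢e) uv uw vw = no-rainbow
    (u , v , w , off-diag uv , off-diag uw , off-diag vw ,
      (λ eq → c≢d (via uv uw eq)) , (λ eq → c≢e (via uv vw eq)) , λ eq → d≢e (via uw vw eq))
    where
    via : ∀ {a b a′ b′ x y} (ab : col a b ≡ just x) (ab′ : col a′ b′ ≡ just y) →
          colour f a b (off-diag ab) ≡ colour f a′ b′ (off-diag ab′) → x ≡ y
    via ab ab′ eq = trans (sym (colour≡ (off-diag ab) ab)) (trans eq (colour≡ (off-diag ab′) ab′))

module _ (f : Coloring 3 (K 17)) (gallai-f : Gallai f) where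
  private
    G : GallaiColouring 17
    G = fromColoring f gallai-f
  open GallaiColouring G
  open Analysis G

  -- At most 5 vertices reached in `d` leave 17 - 2 - 5 = 10 pages that avoid `d`.
  Thin : Fin 17 → Fin 17 → Colour → Set
  Thin u v d = u ≢ v × ¬ (u ─[ d ]─ v) × reach d u v ≤ 5

  opaque
    -- The search is finite, so the proof by contradiction in `thin-exists` yields an actual spine.
    thin? : Dec (∃ λ u → ∃ λ v → ∃ λ d → Thin u v d)
    thin? = any? λ u → any? λ v → any? λ d → ¬? (u ≟ v) ×-dec (¬? (edge? d u v) ×-dec (reach d u v ≤? 5))

  thin-exists : ¬ ¬ (∃ λ u → ∃ λ v → ∃ λ d → Thin u v d)
  thin-exists none = Bookless.impossible G reach≥
    where
    reach≥ : ∀ {d x u v} → d ≢ x → u ─[ x ]─ v → 6 ≤ reach d u v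
    reach≥ {d} {x} {u} {v} d≢x uv with reach d u v ≤? 5
    ... | no big = ≰⇒> big
    ... | yes small = contradiction
      (u , v , d , edge-≢ uv , (λ uv′ → d≢x (edge-unique uv′ uv)) , small) none

  thin⇒book : ∀ {u v d} → Thin u v d → Σ[ c ∈ Copy (Book 10) (K 17) ] UsesAtMost 2 f c
  thin⇒book {u} {v} {d} (u≢v , ¬uv , small) = copy , ∁ ⁅ d ⁆ , ≤-reflexive size-S , in-S
    where
    page? : Decidable _
    page? = (∁? (reach? d u v) ∩? ∁? (_≟ u)) ∩? ∁? (_≟ v)
    10≤pages : 10 ≤ # page?
    10≤pages = +-cancelˡ-≤ 7 10 _ (≤-trans (#-complement (reach? d u v)) (+-mono-≤ small
      (≤-trans (#-remove (∁? (reach? d u v)) u) (s≤s (#-remove _ v)))))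
    pages = enumerate 10 page? 10≤pages
    spine : Fin 2 → Fin 17
    spine 0F = u
    spine 1F = v
    page : Fin 10 → Fin 17
    page = proj₁ pages
    page∈ = proj₂ (proj₂ pages)
    embed′ : Fin 2 ⊎ Fin 10 → Fin 17
    embed′ (inj₁ i) = spine i
    embed′ (inj₂ j) = page j
    spine≢page : ∀ i j → spine i ≢ page j
    spine≢page 0F j eq = proj₂ (proj₁ (page∈ j)) (sym eq)
    spine≢page 1F j eq = proj₂ (page∈ j) (sym eq)
    embed-inj : Injective _≡_ _≡_ embed′
    embed-inj {inj₁ 0F} {inj₁ 0F} eq = refl
    embed-inj {inj₁ 0F} {inj₁ 1F} eq = contradiction eq u≢v
    embed-inj {inj₁ 1F} {inj₁ 0F} eq = contradiction (sym eq) u≢v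
    embed-inj {inj₁ 1F} {inj₁ 1F} eq = refl
    embed-inj {inj₁ i} {inj₂ j} eq = contradiction eq (spine≢page i j)
    embed-inj {inj₂ j} {inj₁ i} eq = contradiction (sym eq) (spine≢page i j)
    embed-inj {inj₂ j} {inj₂ k} eq = cong inj₂ (proj₁ (proj₂ pages) eq)
    distinct : ∀ {a b} → Adj (Book 10) a b → a ≢ b
    distinct {a} ab refl = adj-irrefl (Book 10) {a} ab
    copy : Copy (Book 10) (K 17)
    copy = record
      { embed = embed′ ; injective = embed-inj
      ; preserves = λ {a} {b} ab eq → distinct {a} {b} ab (embed-inj eq) }
    size-S : Subset.∣ ∁ ⁅ d ⁆ ∣ ≡ 2
    size-S = trans (∣∁p∣≡n∸∣p∣ ⁅ d ⁆) (cong (3 ∸_) (∣⁅x⁆∣≡1 d))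
    avoids : ∀ a b → Adj (Book 10) a b → ¬ embed′ a ─[ d ]─ embed′ b
    avoids (inj₁ 0F) (inj₁ 0F) 0≢0 = contradiction refl 0≢0
    avoids (inj₁ 0F) (inj₁ 1F) _   = ¬uv
    avoids (inj₁ 1F) (inj₁ 0F) _   = ¬uv ∘ edge-sym
    avoids (inj₁ 1F) (inj₁ 1F) 1≢1 = contradiction refl 1≢1
    avoids (inj₁ 0F) (inj₂ j)  _   = proj₁ (proj₁ (page∈ j)) ∘ inj₁
    avoids (inj₁ 1F) (inj₂ j)  _   = proj₁ (proj₁ (page∈ j)) ∘ inj₂
    avoids (inj₂ j)  (inj₁ 0F) _   = proj₁ (proj₁ (page∈ j)) ∘ inj₁ ∘ edge-sym
    avoids (inj₂ j)  (inj₁ 1F) _   = proj₁ (proj₁ (page∈ j)) ∘ inj₂ ∘ edge-sym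
    in-S : ∀ a b (ab : Adj (Book 10) a b) →
           colour f (embed′ a) (embed′ b) (preserves copy {a} {b} ab) Subset.∈ ∁ ⁅ d ⁆
    in-S a b ab = x∉p⇒x∈∁p λ c∈ → avoids a b ab
      (recolour (x∈⁅y⁆⇒x≡y d c∈) (proj₂ (col-edge (preserves copy {a} {b} ab))))

arrows-17 : GallaiArrows 3 2 (Book 10) 17
arrows-17 f gal with decidable-stable (thin? f gal) (thin-exists f gal)
... | u , v , d , thin = thin⇒book f gal thin

-- Lower bound

-- The last of the nine cells is the deleted vertex.
cell : Fin 8 → Fin 3 × Fin 3
cell j = remQuot {3} 3 (inject₁ j)

-- Two copies, joined in colour 2, of the Paley graph of order 9 (the 3 × 3 rook's graph) minus a vertex.
shade : Fin 16 → Fin 16 → Colour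
shade u v with remQuot {2} 8 u | remQuot {2} 8 v
... | s , i | t , j with cell i | cell j
... | a , b | a′ , b′ =
  if does (s ≟ t) then (if does (a ≟ a′) ∨ does (b ≟ b′) then 0F else 1F) else 2F

-- On the diagonal `shade` has the default value 0, so both ends are excluded explicitly.
Page : Fin 16 → Fin 16 → Colour → Pred (Fin 16) 0ℓ
Page u v d z = (shade u z ≢ d × shade v z ≢ d) × (z ≢ u × z ≢ v)

page? : ∀ u v d → Decidable (Page u v d)
page? u v d z = (¬? (shade u z ≟ d) ×-dec ¬? (shade v z ≟ d)) ×-dec (¬? (z ≟ u) ×-dec ¬? (z ≟ v))

opaque
  unfolding #

  shade-sym : ∀ u v → shade u v ≡ shade v u
  shade-sym = from-yes (all? {n = 16} λ u → all? {n = 16} λ v → shade u v ≟ shade v u)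

  -- Each copy carries two colours, and a triangle meeting both copies has two edges of colour 2.
  shade-gallai : ∀ u v w → ¬ (shade u v ≢ shade u w × shade u v ≢ shade v w × shade u w ≢ shade v w)
  shade-gallai = from-yes (all? {n = 16} λ u → all? {n = 16} λ v → all? {n = 16} λ w →
    ¬? (¬? (shade u v ≟ shade u w) ×-dec (¬? (shade u v ≟ shade v w) ×-dec ¬? (shade u w ≟ shade v w))))

  -- Checked exhaustively. The value 9 arises inside a copy when `d` is the other of 0 and 1: all 8
  -- vertices of the other copy are pages, and at most one of the same copy is, since adjacent
  -- vertices of the self-complementary Paley graph have one common neighbour.
  few-pages : ∀ u v d → u ≢ v → shade u v ≢ d → # (page? u v d) ≤ 9
  few-pages = from-yes (all? {n = 16} λ u → all? {n = 16} λ v → all? {n = 3} λ d →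
    ¬? (u ≟ v) →-dec (¬? (shade u v ≟ d) →-dec (# (page? u v d) ≤? 9)))

missing : (S : Subset 3) → ∣ S ∣ ≤ 2 → ∃ λ d → d Subset.∉ S
missing S ∣S∣≤2 with any? (λ d → ¬? (d ∈? S))
... | yes found = found
... | no none   = contradiction
  (≤-trans (p⊆q⇒∣p∣≤∣q∣ {p = Subset.⊤} {q = S} (λ {d} _ → decidable-stable (d ∈? S) λ d∉S → none (d , d∉S))) ∣S∣≤2)
  (from-no (3 ≤? 2))

module _ {q} (q≤16 : q ≤ 16) where

  ι : Fin q → Fin 16
  ι u = inject≤ u q≤16

  -- Restricting to the first `q` vertices excludes every `q ≤ 16`, as minimality demands.
  witness : Coloring 3 (K q)
  witness = record
    { colour = λ u v _ → shade (ι u) (ι v) ; colour-sym = λ u v _ → shade-sym (ι u) (ι v) }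

  witness-gallai : Gallai witness
  witness-gallai (u , v , w , _ , _ , _ , rainbow) = shade-gallai (ι u) (ι v) (ι w) rainbow

  -- A colour `d` missing from `S` makes all ten pages of the copy satisfy `Page`, one more than
  -- `few-pages` allows.
  witness-bookless : ¬ (Σ[ c ∈ Copy (Book 10) (K q) ] UsesAtMost 2 witness c)
  witness-bookless (c , S , ∣S∣≤2 , in-S) with missing S ∣S∣≤2
  ... | d , d∉S = contradiction
    (≤-trans
      (#-injective (page? (x (inj₁ 0F)) (x (inj₁ 1F)) d) (x ∘ inj₂) (inj₂-injective ∘ x-inj)
        λ j → (avoids (inj₁ 0F) (inj₂ j) tt , avoids (inj₁ 1F) (inj₂ j) tt) ,
              (λ eq → contradiction (x-inj eq) λ ()) , (λ eq → contradiction (x-inj eq) λ ()))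
      (few-pages _ _ d (λ eq → contradiction (x-inj eq) λ ()) (avoids (inj₁ 0F) (inj₁ 1F) λ ())))
    (from-no (10 ≤? 9))
    where
    x : Vertex (Book 10) → Fin 16
    x = ι ∘ embed c
    x-inj : Injective _≡_ _≡_ x
    x-inj eq = injective c (inject≤-injective q≤16 q≤16 _ _ eq)
    avoids : ∀ a b → Adj (Book 10) a b → shade (x a) (x b) ≢ d
    avoids a b ab eq = d∉S (subst (Subset._∈ S) eq (in-S a b ab))

arrows⇒17≤ : ∀ q → GallaiArrows 3 2 (Book 10) q → 17 ≤ q
arrows⇒17≤ q arrows with 17 ≤? q
... | yes 17≤q = 17≤q
... | no 17≰q  = contradiction (arrows (witness q≤16) (witness-gallai q≤16)) (witness-bookless q≤16)
  where
  q≤16 : q ≤ 16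
  q≤16 = s≤s⁻¹ (≰⇒> 17≰q)

theorem4p6 : gr[ 3 , 2 ] (Book 10) ≈ 17
theorem4p6 = arrows-17 , arrows⇒17≤
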